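{- There exists $R_0$ such that the following holds. Let $q\ge 1$ and $r$ be integers with $R_0\le r\le 0.01q$, and let $n=q^2+q+1-r$ (so $n\in\{q^2+1,\dots,q^2+q\}$). Then $$\mathrm{ex}(n,C_4)=\mathrm{ex}(q^2+q+1-r,C_4)\le \frac12 q(q+1)^2-0.92\,rq.$$
   Context: $\mathrm{ex}(n,C_4)$ denotes the maximum number of edges in an $n$-vertex simple graph containing no cycle of length four as a subgraph. -}

module Defs where

open import Data.Nat using (ℕ; zero; suc; _+_; _*_; _≤_; _<ᵇ_)
open import Data.Fin using (Fin; toℕ) renaming (zero to fzero; suc to fsuc)
open import Data.Bool using (Bool; true; false; if_then_else_; _∧_)
open import Relation.Binary.PropositionalEquality using (_≡_; _≢_)
open import Data.Product using (Σ; _×_)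

record Graph (n : ℕ) : Set where
  field
    adj     : Fin n → Fin n → Bool
    sym     : ∀ i j → adj i j ≡ adj j i
    irrefl  : ∀ i → adj i i ≡ false

open Graph public

sumFin : ∀ {m} → (Fin m → ℕ) → ℕ
sumFin {zero}  f = 0
sumFin {suc m} f = f fzero + sumFin (λ i → f (fsuc i))

bit : Bool → ℕ
bit true  = 1
bit false = 0

edgeCount : ∀ {n} → Graph n → ℕ
edgeCount {n} G = sumFin (λ i → sumFin (λ j → bit ((toℕ i <ᵇ toℕ j) ∧ adj G i j)))

Adj : ∀ {n} → Graph n → Fin n → Fin n → Set
Adj G i j = adj G i j ≡ true

HasC4 : ∀ {n} → Graph n → Set
HasC4 {n} G =
  Σ (Fin n) λ a → Σ (Fin n) λ b → Σ (Fin n) λ c → Σ (Fin n) λ d →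
    (a ≢ b) × (a ≢ c) × (a ≢ d) × (b ≢ c) × (b ≢ d) × (c ≢ d) ×
    Adj G a b × Adj G b c × Adj G c d × Adj G d a

C4Free : ∀ {n} → Graph n → Set
C4Free G = HasC4 G → ⊥'
  where open import Data.Empty renaming (⊥ to ⊥')

{-# OPTIONS --safe #-}

-- Write n = q² + q + 1 − r and let x v = q + 1 − deg v be the deficiency of v.
-- Since two vertices have at most one common neighbour, counting paths of
-- length two from v gives Σ_{u ~ v} x u ≥ r − q x v.  Let z be the size of
-- Z = {x ≤ 0}, with indicator s, let S = Σ x, and let Y ≥ 0 be the total of −x on Z.
-- Summing the inequality over Z gives r z ≤ q S.  If the bound fails then
-- S ≤ 0.85 r q, so z ≤ 0.85 q²: many vertices have x ≥ 1, and as S is small,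
-- Y ≥ 0.141 q².  Summing over all vertices gives Σ x² ≤ 0.007 q³.  The numbers
-- t v of neighbours of v in Z have small variance (expander mixing), which makes
-- Σ x t nearly z S / q ≤ r z; but Σ x t ≥ r z + q Y, a contradiction.

module Submission where

open import Defs
open import Data.Bool using (Bool; true; false; _∧_)
open import Data.Empty using (⊥; ⊥-elim)
open import Data.Fin using (Fin; zero; suc; toℕ)
import Data.Fin as Fin
open import Data.Fin.Properties using (suc-injective; toℕ-injective)
import Data.Integer as ℤ
import Data.Integer.Properties as ℤ
open import Data.Nat as ℕ using (ℕ; zero; suc; z≤n; s≤s)
import Data.Nat.Properties as ℕ
open import Data.Product using (Σ; _×_; _,_)
open import Relation.Binary.PropositionalEquality using (_≡_; _≢_; refl; trans; cong; cong₂; subst; subst₂)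
  renaming (sym to ≡-sym)
open import Relation.Nullary using (yes; no)

module DegreeDeficiency where

  open import Algebra.Properties.Semiring.Sum ℤ.+-*-semiring
    using (sum; sum-cong-≗; ∑-comm; ∑-distrib-+; *-distribˡ-sum; sum-replicate-zero)
  open import Data.Integer hiding (suc)
  open import Data.Integer.Properties hiding (_≟_)
  open import Data.Integer.Tactic.RingSolver using (solve-∀)

  -- Integer inequalities and finite sums.

  infixl 6 _⊕_
  infixl 7 _⊗_

  _⊕_ : ∀ {a b} → 0ℤ ≤ a → 0ℤ ≤ b → 0ℤ ≤ a + b
  _⊕_ = +-mono-≤

  _⊗_ : ∀ {a b} → 0ℤ ≤ a → 0ℤ ≤ b → 0ℤ ≤ a * b
  _⊗_ {+ m} {+ n} _ _ = subst (0ℤ ≤_) (pos-* m n) (+≤+ z≤n)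

  0≤+ : ∀ n → 0ℤ ≤ + n
  0≤+ n = +≤+ z≤n

  -- The common shape of the estimates below: a nonnegative combination of hypotheses, assembled
  -- from `gap`, `_⊕_` and `_⊗_`, is matched with the difference of the two sides by a ring
  -- identity.
  certificate : ∀ {a b c} → 0ℤ ≤ c → c ≡ b - a → a ≤ b
  certificate p e = 0≤i-j⇒j≤i (subst (0ℤ ≤_) e p)

  gap : ∀ {a b} → a ≤ b → 0ℤ ≤ b - a
  gap = i≤j⇒0≤j-i

  square-nonneg : ∀ i → 0ℤ ≤ i * i
  square-nonneg (+ m)      = 0≤+ m ⊗ 0≤+ m
  square-nonneg (-[1+ m ]) = +≤+ z≤n

  one : ∀ {n} → Fin n → ℤ
  one _ = 1ℤ

  ⟨_,_⟩ : ∀ {n} → (Fin n → ℤ) → (Fin n → ℤ) → ℤ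
  ⟨ f , g ⟩ = sum (λ i → f i * g i)

  sum-mono : ∀ {n} {f g : Fin n → ℤ} → (∀ i → f i ≤ g i) → sum f ≤ sum g
  sum-mono {zero}  h = ≤-refl
  sum-mono {suc n} h = +-mono-≤ (h zero) (sum-mono (λ i → h (suc i)))

  sum-nonneg : ∀ {n} {f : Fin n → ℤ} → (∀ i → 0ℤ ≤ f i) → 0ℤ ≤ sum f
  sum-nonneg {zero}  h = ≤-refl
  sum-nonneg {suc n} h = h zero ⊕ sum-nonneg (λ i → h (suc i))

  sum-one : ∀ n → sum (one {n}) ≡ + n
  sum-one zero    = refl
  sum-one (suc n) = cong (λ m → 1ℤ + m) (sum-one n)

  ⟨one,⟩ : ∀ {n} (h : Fin n → ℤ) → ⟨ one , h ⟩ ≡ sum h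
  ⟨one,⟩ h = sum-cong-≗ λ v → *-identityˡ (h v)

  sum-linear : ∀ {n} α β (f g : Fin n → ℤ) → sum (λ i → α * f i + β * g i) ≡ α * sum f + β * sum g
  sum-linear α β f g = trans (∑-distrib-+ (λ i → α * f i) (λ i → β * g i))
    (≡-sym (cong₂ _+_ (*-distribˡ-sum α f) (*-distribˡ-sum β g)))

  sum-affine-square : ∀ {n} α β γ (f g : Fin n → ℤ) →
    sum (λ i → (α * f i + β * g i + γ) * (α * f i + β * g i + γ))
      ≡ α * α * ⟨ f , f ⟩ + β * β * ⟨ g , g ⟩ + γ * γ * sum (one {n})
        + + 2 * α * β * ⟨ f , g ⟩ + + 2 * α * γ * sum f + + 2 * β * γ * sum g
  sum-affine-square {zero}  α β γ f g = base α β γ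
    where
    base : ∀ α β γ → 0ℤ ≡ α * α * 0ℤ + β * β * 0ℤ + γ * γ * 0ℤ
      + + 2 * α * β * 0ℤ + + 2 * α * γ * 0ℤ + + 2 * β * γ * 0ℤ
    base = solve-∀
  sum-affine-square {suc n} α β γ f g =
    trans (cong (λ m → (α * f zero + β * g zero + γ) * (α * f zero + β * g zero + γ) + m)
                (sum-affine-square α β γ f′ g′))
          (step α β γ (f zero) (g zero) ⟨ f′ , f′ ⟩ ⟨ g′ , g′ ⟩ (sum (one {n})) ⟨ f′ , g′ ⟩ (sum f′) (sum g′))
    where
    f′ g′ : Fin n → ℤ
    f′ i = f (suc i)
    g′ i = g (suc i)
    step : ∀ α β γ x y xx yy n xy sx sy →
      (α * x + β * y + γ) * (α * x + β * y + γ) + (α * α * xx + β * β * yy + γ * γ * n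
        + + 2 * α * β * xy + + 2 * α * γ * sx + + 2 * β * γ * sy)
      ≡ α * α * (x * x + xx) + β * β * (y * y + yy) + γ * γ * (1ℤ + n)
        + + 2 * α * β * (x * y + xy) + + 2 * α * γ * (x + sx) + + 2 * β * γ * (y + sy)
    step = solve-∀

  -- The term at `v` is corrected exactly instead of estimated. This suits a row of the squared
  -- adjacency matrix, whose entries are at most 1 except on the diagonal.
  sum-mono-except : ∀ {n} (v : Fin n) (f g : Fin n → ℤ) → (∀ w → w ≢ v → f w ≤ g w) →
    sum f ≤ sum g + (f v - g v)
  sum-mono-except zero f g h =
    certificate (gap (sum-mono (λ i → h (suc i) λ ()))) (e (f zero) (g zero) _ _)
    where
    e : ∀ a b s t → t - s ≡ b + t + (a - b) - (a + s)
    e = solve-∀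
  sum-mono-except (suc v) f g h =
    ≤-trans (+-mono-≤ (h zero λ ())
              (sum-mono-except v (λ i → f (suc i)) (λ i → g (suc i)) (λ w w≢v → h (suc w) λ { refl → w≢v refl })))
      (≤-reflexive (≡-sym (+-assoc (g zero) _ _)))

  -- Zero-one indicators and positive parts.

  sum-bits-≤1 : ∀ {n} (b : Fin n → Bool) → (∀ i j → b i ≡ true → b j ≡ true → i ≡ j) →
    sum (λ i → + bit (b i)) ≤ 1ℤ
  sum-bits-≤1 {zero}  b h = +≤+ z≤n
  sum-bits-≤1 {suc n} b h with b zero in b₀
  ... | false = ≤-trans (≤-reflexive (+-identityˡ _))
                  (sum-bits-≤1 (λ i → b (suc i)) λ i j bi bj → suc-injective (h (suc i) (suc j) bi bj))
  ... | true = +-monoʳ-≤ 1ℤ (≤-trans (sum-mono rest) (≤-reflexive (sum-replicate-zero n)))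
    where
    rest : ∀ i → + bit (b (suc i)) ≤ 0ℤ
    rest i with b (suc i) in bi
    ... | false = ≤-refl
    ... | true with () ← h zero (suc i) b₀ bi

  bit-∧ : ∀ b c → + bit b * + bit c ≡ + bit (b ∧ c)
  bit-∧ true  true  = refl
  bit-∧ true  false = refl
  bit-∧ false true  = refl
  bit-∧ false false = refl

  bit-idem : ∀ b → + bit b * + bit b ≡ + bit b
  bit-idem true  = refl
  bit-idem false = refl

  nonposBit : ℤ → ℤ
  nonposBit (+ suc _) = 0ℤ
  nonposBit +0        = 1ℤ
  nonposBit (-[1+ _ ]) = 1ℤ

  0≤nonposBit : ∀ i → 0ℤ ≤ nonposBit i
  0≤nonposBit (+ suc _)  = ≤-refl
  0≤nonposBit +0         = +≤+ z≤n
  0≤nonposBit (-[1+ _ ]) = +≤+ z≤n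

  nonposBit≤1 : ∀ i → nonposBit i ≤ 1ℤ
  nonposBit≤1 (+ suc _)  = +≤+ z≤n
  nonposBit≤1 +0         = ≤-refl
  nonposBit≤1 (-[1+ _ ]) = ≤-refl

  nonposBit-idem : ∀ i → nonposBit i * nonposBit i ≡ nonposBit i
  nonposBit-idem (+ suc _)  = refl
  nonposBit-idem +0         = refl
  nonposBit-idem (-[1+ _ ]) = refl

  nonposBit*≤0 : ∀ i → nonposBit i * i ≤ 0ℤ
  nonposBit*≤0 (+ suc _)  = ≤-refl
  nonposBit*≤0 +0         = ≤-refl
  nonposBit*≤0 (-[1+ _ ]) = -≤+

  -- The right side is the positive part of `i`; by integrality it is at least 1 once `i` is
  -- positive.
  1-nonposBit≤ : ∀ i → 1ℤ - nonposBit i ≤ i - nonposBit i * i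
  1-nonposBit≤ (+ suc n)  = +≤+ (s≤s z≤n)
  1-nonposBit≤ +0         = ≤-refl
  1-nonposBit≤ i@(-[1+ _ ]) = ≤-reflexive (≡-sym (trans (cong (λ j → i - j) (*-identityˡ i)) (+-inverseʳ i)))

  -- If `x` is at least 1, then `t ≤ q + 1 - x ≤ q`. If `x ≤ 0`, the product is at most 0 and the
  -- positive part of `x` vanishes.
  *≤*-nonposBit : ∀ q x t → 0ℤ ≤ q → 0ℤ ≤ t → t ≤ q + 1ℤ - x → x * t ≤ q * (x - nonposBit x * x)
  *≤*-nonposBit q x@(+ suc k) t _ _ t≤ =
    certificate (0≤+ (suc k) ⊗ (gap t≤ ⊕ gap {1ℤ} {x} (+≤+ (s≤s z≤n)))) (e q x t)
    where
    e : ∀ q x t → x * (q + 1ℤ - x - t + (x - 1ℤ)) ≡ q * (x - 0ℤ * x) - x * t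
    e = solve-∀
  *≤*-nonposBit q +0 t 0≤q _ _ = ≤-reflexive (≡-sym (*-zeroʳ q))
  *≤*-nonposBit q x@(-[1+ k ]) t _ 0≤t _ =
    certificate (0≤+ (suc k) ⊗ 0≤t) (e q x t)
    where
    e : ∀ q x t → - x * t ≡ q * (x - 1ℤ * x) - x * t
    e = solve-∀

  -- Off the diagonal exactly one of the two comparisons holds; on it both sides are 0. This splits
  -- ordered adjacent pairs for the handshake identity.
  bit-trichotomy : ∀ m n b → (m ≡ n → b ≡ false) →
    + bit b ≡ + bit ((m ℕ.<ᵇ n) ∧ b) + + bit ((n ℕ.<ᵇ m) ∧ b)
  bit-trichotomy zero    zero    b h = cong (λ c → + bit c) (h refl)
  bit-trichotomy zero    (suc n) b h = ≡-sym (+-identityʳ _)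
  bit-trichotomy (suc m) zero    b h = ≡-sym (+-identityˡ _)
  bit-trichotomy (suc m) (suc n) b h = bit-trichotomy m n b λ e → h (cong suc e)

  +sumFin : ∀ {n} (f : Fin n → ℕ) → + sumFin f ≡ sum (λ i → + f i)
  +sumFin {zero}  f = refl
  +sumFin {suc n} f = cong (λ m → + f zero + m) (+sumFin (λ i → f (suc i)))

  -- The inequalities among the moments are incompatible.

  numerical-contradiction : ∀ q r z S Y N X T →
    let n = q * q + q + + 1 - r in
    1ℤ ≤ q → 1ℤ ≤ r → + 100 * r ≤ q → 0ℤ ≤ z → 0ℤ ≤ Y →
    + 20 * S ≤ + 17 * r * q →
    r * z + q * Y ≤ X → X ≤ q * (S + Y) →
    n - z ≤ S + Y →
    N ≤ (+ 2 * q + + 1) * S - n * r →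
    T ≤ z * z + q * z + Y →
    0ℤ ≤ + 121 * q * q * N + q * q * T + n * z * z - + 22 * q * q * X + + 22 * q * z * S
          - + 2 * q * z * ((q + + 1) * z + Y) →
    ⊥
  numerical-contradiction q r z S Y N X T 1≤q 1≤r 100r≤q 0≤z 0≤Y hS hX₁ hX₂ hY hN hT hsq =
    absurd q 1≤q (certificate cert (eq q r z S Y N X T))
    where
    0≤q : 0ℤ ≤ q
    0≤q = ≤-trans (0≤+ 1) 1≤q
    0≤r : 0ℤ ≤ r
    0≤r = ≤-trans (0≤+ 1) 1≤r
    -- The two bounds on `X` share the term `q * Y`, so `r z ≤ q S ≤ 0.85 r q²`, and `r` cancels.
    hz : + 20 * z ≤ + 17 * q * q
    hz = cancel r 1≤r (certificate (0≤q ⊗ gap hS ⊕ 0≤+ 20 ⊗ (gap hX₁ ⊕ gap hX₂)) (e q r z S Y X))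
      where
      e : ∀ q r z S Y X → q * (+ 17 * r * q - + 20 * S) + + 20 * ((X - (r * z + q * Y)) + (q * (S + Y) - X))
          ≡ r * (+ 17 * q * q) - r * (+ 20 * z)
      e = solve-∀
      cancel : ∀ r {a b} → 1ℤ ≤ r → r * a ≤ r * b → a ≤ b
      cancel +[1+ r ] {a} {b} _ h = *-cancelˡ-≤-pos a b +[1+ r ] h
      cancel +0 (+≤+ ())
    -- From `Y ≥ n - z - S` with `z ≤ 0.85 q²` and `S ≤ 0.85 r q ≤ 0.0085 q²`; the remainder
    -- `q + 1 - r` of `n` is nonnegative.
    hY′ : + 141 * q * q ≤ + 1000 * Y
    hY′ = *-cancelˡ-≤-pos _ _ (+ 2) (certificate
      (0≤+ 2000 ⊗ gap hY ⊕ 0≤+ 100 ⊗ gap hz ⊕ 0≤+ 100 ⊗ gap hS ⊕ 0≤+ 17 ⊗ 0≤q ⊗ gap 100r≤q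
        ⊕ 0≤q ⊗ 0≤q ⊕ 0≤+ 2000 ⊕ 0≤+ 1980 ⊗ 0≤q ⊕ 0≤+ 20 ⊗ gap 100r≤q) (e q r z S Y))
      where
      e : ∀ q r z S Y → + 2000 * (S + Y - (q * q + q + + 1 - r - z)) + + 100 * (+ 17 * q * q - + 20 * z)
          + + 100 * (+ 17 * r * q - + 20 * S) + + 17 * q * (q - + 100 * r)
          + q * q + + 2000 + + 1980 * q + + 20 * (q - + 100 * r)
          ≡ + 2 * (+ 1000 * Y) - + 2 * (+ 141 * q * q)
      e = solve-∀
    -- The main terms are `2 q S ≤ 1.7 r q²` and `- r q²`, leaving `0.7 r q² ≤ 0.007 q³`.
    hN′ : + 2000 * N ≤ + 14 * q * q * q
    hN′ = certificate
      (0≤+ 2000 ⊗ gap hN ⊕ 0≤+ 100 ⊗ (0≤+ 2 ⊗ 0≤q ⊕ 0≤+ 1) ⊗ gap hS ⊕ 0≤+ 14 ⊗ 0≤q ⊗ 0≤q ⊗ gap 100r≤q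
        ⊕ 0≤+ 2000 ⊗ 0≤r ⊕ 0≤+ 280 ⊗ 0≤r ⊗ 0≤q ⊕ 0≤+ 20 ⊗ 0≤r ⊗ gap 100r≤q) (e q r S N)
      where
      e : ∀ q r S N → + 2000 * ((+ 2 * q + + 1) * S - (q * q + q + + 1 - r) * r - N)
          + + 100 * (+ 2 * q + + 1) * (+ 17 * r * q - + 20 * S) + + 14 * q * q * (q - + 100 * r)
          + + 2000 * r + + 280 * r * q + + 20 * r * (q - + 100 * r)
          ≡ + 14 * q * q * q - + 2000 * N
      e = solve-∀
    hS′ : S ≤ r * q
    hS′ = *-cancelˡ-≤-pos _ _ (+ 20) (certificate (gap hS ⊕ 0≤+ 3 ⊗ 0≤r ⊗ 0≤q) (e q r S))
      where
      e : ∀ q r S → + 17 * r * q - + 20 * S + + 3 * r * q ≡ + 20 * (r * q) - + 20 * S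
      e = solve-∀
    -- The factor 2000 clears denominators. The terms in `z²` add up to `- z² (q - 1 + r)`, and
    -- `22 q z S` is absorbed by `22 q² r z` from the lower bound on `X`. In units of `q⁵` there
    -- remain at most 121 · 0.007 from `N`, 0.85 from `q³ z` and -21 · 0.141 from `Y`: in total
    -- -1.264, that is, -2528 after scaling.
    cert = 0≤+ 2000 ⊗ hsq ⊕ 0≤+ 2000 ⊗ 0≤q ⊗ 0≤q ⊗ gap hT ⊕ 0≤+ 44000 ⊗ 0≤q ⊗ 0≤q ⊗ gap hX₁
      ⊕ 0≤+ 2000 ⊗ 0≤z ⊗ 0≤z ⊗ (gap 1≤q ⊕ 0≤r) ⊕ 0≤+ 4000 ⊗ 0≤q ⊗ 0≤z ⊗ 0≤Y
      ⊕ 0≤+ 44000 ⊗ 0≤q ⊗ 0≤z ⊗ gap hS′ ⊕ 0≤+ 2000 ⊗ 0≤q ⊗ 0≤q ⊗ 0≤Y ⊗ gap 1≤q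
      ⊕ 0≤+ 121 ⊗ 0≤q ⊗ 0≤q ⊗ gap hN′ ⊕ 0≤+ 100 ⊗ 0≤q ⊗ 0≤q ⊗ 0≤q ⊗ gap hz
      ⊕ 0≤+ 42 ⊗ 0≤q ⊗ 0≤q ⊗ 0≤q ⊗ gap hY′
    eq : ∀ q r z S Y N X T →
      + 2000 * (+ 121 * q * q * N + q * q * T + (q * q + q + + 1 - r) * z * z - + 22 * q * q * X
         + + 22 * q * z * S - + 2 * q * z * ((q + + 1) * z + Y))
      + + 2000 * q * q * (z * z + q * z + Y - T) + + 44000 * q * q * (X - (r * z + q * Y))
      + + 2000 * z * z * (q - + 1 + r) + + 4000 * q * z * Y + + 44000 * q * z * (r * q - S)
      + + 2000 * q * q * Y * (q - + 1) + + 121 * q * q * (+ 14 * q * q * q - + 2000 * N)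
      + + 100 * q * q * q * (+ 17 * q * q - + 20 * z) + + 42 * q * q * q * (+ 1000 * Y - + 141 * q * q)
      ≡ 0ℤ - + 2528 * (q * q * q * q * q)
    eq = solve-∀
    absurd : ∀ q → 1ℤ ≤ q → + 2528 * (q * q * q * q * q) ≤ 0ℤ → ⊥
    absurd +[1+ k ] _ (+≤+ ())
    absurd +0 (+≤+ ())

  -- The adjacency operator of a graph.

  module _ {n : ℕ} (G : Graph n) where

    a : Fin n → Fin n → ℤ
    a u v = + bit (adj G u v)

    A : (Fin n → ℤ) → Fin n → ℤ
    A h v = ⟨ a v , h ⟩

    deg : Fin n → ℤ
    deg = A one

    0≤a : ∀ u v → 0ℤ ≤ a u v
    0≤a u v = +≤+ z≤n

    -- Symmetry of the adjacency matrix, after exchanging the two summations.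
    A-adjoint : ∀ g h → ⟨ g , A h ⟩ ≡ ⟨ h , A g ⟩
    A-adjoint g h = trans (sum-cong-≗ λ u → *-distribˡ-sum (g u) (λ v → a u v * h v))
      (trans (∑-comm λ u v → g u * (a u v * h v))
        (sum-cong-≗ λ v → trans (sum-cong-≗ λ u → swap u v) (≡-sym (*-distribˡ-sum (h v) (λ u → a v u * g u)))))
      where
      e : ∀ x y z → x * (y * z) ≡ z * (y * x)
      e = solve-∀
      swap : ∀ u v → g u * (a u v * h v) ≡ h v * (a v u * g u)
      swap u v rewrite sym G u v = e (g u) (a v u) (h v)

    A-mono : ∀ {g h} → (∀ v → g v ≤ h v) → ∀ v → A g v ≤ A h v
    A-mono g≤h v = sum-mono λ u → *-monoˡ-≤-nonNeg (a v u) (g≤h u)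

    0≤A : ∀ {h} → (∀ v → 0ℤ ≤ h v) → ∀ v → 0ℤ ≤ A h v
    0≤A 0≤h v = sum-nonneg λ u → 0≤a v u ⊗ 0≤h u

    -- Handshake identity: `edgeCount` sees only the pairs with `i < j`, and transposing the double
    -- sum gives the other half.
    sum-deg : sum deg ≡ + 2 * + edgeCount G
    sum-deg = begin-equality
      sum deg
        ≡⟨ sum-cong-≗ (λ i → trans (sum-cong-≗ (pointwise i)) (∑-distrib-+ (b i) (λ j → b j i))) ⟩
      sum (λ i → sum (b i) + sum (λ j → b j i))
        ≡⟨ ∑-distrib-+ (λ i → sum (b i)) (λ i → sum (λ j → b j i)) ⟩
      sum (λ i → sum (b i)) + sum (λ i → sum (λ j → b j i))
        ≡⟨ cong (λ m → sum (λ i → sum (b i)) + m) (∑-comm (λ i j → b j i)) ⟩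
      sum (λ i → sum (b i)) + sum (λ i → sum (b i))
        ≡⟨ cong (λ m → m + m) (≡-sym (trans (+sumFin (λ i → sumFin (β i)))
            (sum-cong-≗ λ i → +sumFin (β i)))) ⟩
      + edgeCount G + + edgeCount G
        ≡⟨ double (+ edgeCount G) ⟩
      + 2 * + edgeCount G ∎
      where
      open ≤-Reasoning
      double : ∀ m → m + m ≡ + 2 * m
      double = solve-∀
      β : Fin n → Fin n → ℕ
      β i j = bit ((toℕ i ℕ.<ᵇ toℕ j) ∧ adj G i j)
      b : Fin n → Fin n → ℤ
      b i j = + β i j
      pointwise : ∀ i j → a i j * 1ℤ ≡ b i j + b j i
      pointwise i j rewrite sym G j i = trans (*-identityʳ _) (bit-trichotomy (toℕ i) (toℕ j) (adj G i j)
        λ e → trans (cong (adj G i) (≡-sym (toℕ-injective e))) (irrefl G i))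

    -- Codegrees in a graph without four-cycles.

    module _ (free : C4Free G) where

      -- `A (a v) w` counts common neighbours of `v` and `w`; two distinct ones `i`, `j` would close
      -- the four-cycle `w`, `i`, `v`, `j`.
      codegree≤1 : ∀ {v w} → w ≢ v → A (a v) w ≤ 1ℤ
      codegree≤1 {v} {w} w≢v = ≤-trans (≤-reflexive (sum-cong-≗ λ u → bit-∧ (adj G w u) (adj G v u)))
        (sum-bits-≤1 (λ u → adj G w u ∧ adj G v u) unique)
        where
        split : ∀ b c → b ∧ c ≡ true → b ≡ true × c ≡ true
        split true true refl = refl , refl
        adj⇒≢ : ∀ {i j} → Adj G i j → i ≢ j
        adj⇒≢ {i} p refl with () ← trans (≡-sym p) (irrefl G i)
        unique : ∀ i j → adj G w i ∧ adj G v i ≡ true → adj G w j ∧ adj G v j ≡ true → i ≡ j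
        unique i j p q with i Fin.≟ j
        ... | yes i≡j = i≡j
        ... | no i≢j with split (adj G w i) _ p | split (adj G w j) _ q
        ...   | wi , vi | wj , vj = ⊥-elim (free
          (w , i , v , j , adj⇒≢ wi , w≢v , adj⇒≢ wj , (λ e → adj⇒≢ vi (≡-sym e)) , i≢j , adj⇒≢ vj
            , wi , trans (sym G i v) vi , vj , trans (sym G j w) wj))

      -- The squared matrix has off-diagonal entries at most 1 and the degrees on its diagonal, so
      -- on nonnegative vectors it is dominated by the all-ones matrix plus the diagonal matrix of
      -- `deg v - 1`.
      A²-bound : ∀ h → (∀ v → 0ℤ ≤ h v) → ∀ v → A (A h) v ≤ sum h + h v * (deg v - 1ℤ)
      A²-bound h 0≤h v = ≤-trans (≤-reflexive (A-adjoint (a v) h))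
        (≤-trans (sum-mono-except v _ h off-diagonal) (≤-reflexive (cong (λ m → sum h + m) diagonal)))
        where
        off-diagonal : ∀ w → w ≢ v → h w * A (a v) w ≤ h w
        off-diagonal w w≢v = certificate (0≤h w ⊗ gap (codegree≤1 w≢v)) (e (h w) _)
          where
          e : ∀ x y → x * (1ℤ - y) ≡ x - x * y
          e = solve-∀
        e : ∀ x d → x * d - x ≡ x * (d - 1ℤ)
        e = solve-∀
        diagonal : h v * A (a v) v - h v ≡ h v * (deg v - 1ℤ)
        diagonal = trans (cong (λ d → h v * d - h v)
          (sum-cong-≗ λ u → trans (bit-idem (adj G v u)) (≡-sym (*-identityʳ (a v u))))) (e (h v) (deg v))

      -- Deficiencies and their moments.

      module _ (q r : ℤ) (n≡ : + n ≡ q * q + q + 1ℤ - r) where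
        open ≤-Reasoning

        x s t : Fin n → ℤ
        x v = q + 1ℤ - deg v
        s v = nonposBit (x v)
        t = A s

        S z Y X N T : ℤ
        S = sum x
        z = sum s
        Y = - ⟨ s , x ⟩
        X = ⟨ x , t ⟩
        N = ⟨ x , x ⟩
        T = ⟨ t , t ⟩

        A-x : ∀ v → A x v ≡ (q + 1ℤ) * deg v - A deg v
        A-x v = begin-equality
          sum (λ u → a v u * (q + 1ℤ - deg u))
            ≡⟨ sum-cong-≗ (λ u → e q (a v u) (deg u)) ⟩
          sum (λ u → (q + 1ℤ) * (a v u * 1ℤ) + -1ℤ * (a v u * deg u))
            ≡⟨ sum-linear (q + 1ℤ) -1ℤ (λ u → a v u * 1ℤ) (λ u → a v u * deg u) ⟩
          (q + 1ℤ) * deg v + -1ℤ * A deg v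
            ≡⟨ cong (λ m → (q + 1ℤ) * deg v + m) (-1*i≡-i (A deg v)) ⟩
          (q + 1ℤ) * deg v - A deg v ∎
          where
          e : ∀ q a d → a * (q + 1ℤ - d) ≡ (q + 1ℤ) * (a * 1ℤ) + -1ℤ * (a * d)
          e = solve-∀

        -- `A²-bound` for the all-ones vector gives `A deg v ≤ n + deg v - 1`; the rest is the value
        -- of `n`.
        A-x-bound : ∀ v → r - q * x v ≤ A x v
        A-x-bound v = begin
          r - q * x v                                       ≡⟨ e q r (deg v) ⟩
          (q + 1ℤ) * deg v - (q * q + q + 1ℤ - r + 1ℤ * (deg v - 1ℤ))
            ≡⟨ cong (λ m → (q + 1ℤ) * deg v - (m + 1ℤ * (deg v - 1ℤ))) (≡-sym (trans (sum-one n) n≡)) ⟩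
          (q + 1ℤ) * deg v - (sum (one {n}) + 1ℤ * (deg v - 1ℤ))
            ≤⟨ +-monoʳ-≤ ((q + 1ℤ) * deg v) (neg-mono-≤ (A²-bound one (λ _ → +≤+ z≤n) v)) ⟩
          (q + 1ℤ) * deg v - A deg v                        ≡⟨ A-x v ⟨
          A x v ∎
          where
          e : ∀ q r d → r - q * (q + 1ℤ - d) ≡ (q + 1ℤ) * d - (q * q + q + 1ℤ - r + 1ℤ * (d - 1ℤ))
          e = solve-∀

        -- Averages `A-x-bound` with weights `h` and moves `A` across the product. The weight `s`
        -- will bound `X` from below, the weight `one` will bound `N` from above.
        weighted-bound : ∀ h → (∀ v → 0ℤ ≤ h v) → r * sum h - q * ⟨ h , x ⟩ ≤ ⟨ x , A h ⟩
        weighted-bound h 0≤h = begin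
          r * sum h - q * ⟨ h , x ⟩               ≡⟨ e r q _ _ ⟩
          r * sum h + - q * ⟨ h , x ⟩             ≡⟨ sum-linear r (- q) h _ ⟨
          sum (λ v → r * h v + - q * (h v * x v)) ≤⟨ sum-mono (λ v → certificate (0≤h v ⊗ gap (A-x-bound v)) (e′ r q (h v) (x v) _)) ⟩
          ⟨ h , A x ⟩                             ≡⟨ A-adjoint h x ⟩
          ⟨ x , A h ⟩ ∎
          where
          e : ∀ r q a b → r * a - q * b ≡ r * a + - q * b
          e = solve-∀
          e′ : ∀ r q h x y → h * (y - (r - q * x)) ≡ h * y - (r * h + - q * (h * x))
          e′ = solve-∀

        0≤s : ∀ v → 0ℤ ≤ s v
        0≤s v = 0≤nonposBit (x v)

        X-lower : r * z + q * Y ≤ X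
        X-lower = ≤-trans (≤-reflexive (e r q z _)) (weighted-bound s 0≤s)
          where
          e : ∀ r q z y → r * z + q * (- y) ≡ r * z - q * y
          e = solve-∀

        deg≡ : ∀ v → deg v ≡ q + 1ℤ - x v
        deg≡ v = e q (deg v)
          where
          e : ∀ q d → d ≡ q + 1ℤ - (q + 1ℤ - d)
          e = solve-∀

        x-sx : ∀ α → sum (λ v → α * (x v - s v * x v)) ≡ α * (S + Y)
        x-sx α = begin-equality
          sum (λ v → α * (x v - s v * x v))             ≡⟨ sum-cong-≗ (λ v → e α (x v) (s v)) ⟩
          sum (λ v → α * x v + - α * (s v * x v))       ≡⟨ sum-linear α (- α) x _ ⟩
          α * S + - α * ⟨ s , x ⟩                       ≡⟨ e′ α S _ ⟩
          α * (S + Y) ∎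
          where
          e : ∀ α x s → α * (x - s * x) ≡ α * x + - α * (s * x)
          e = solve-∀
          e′ : ∀ α x s → α * x + - α * s ≡ α * (x + - s)
          e′ = solve-∀

        X-upper : 0ℤ ≤ q → X ≤ q * (S + Y)
        X-upper 0≤q = begin
          X ≤⟨ sum-mono (λ v → *≤*-nonposBit q (x v) (t v) 0≤q (0≤A 0≤s v)
                 (≤-trans (A-mono (λ u → nonposBit≤1 (x u)) v) (≤-reflexive (deg≡ v)))) ⟩
          sum (λ v → q * (x v - s v * x v)) ≡⟨ x-sx q ⟩
          q * (S + Y) ∎

        -- `S + Y` is the sum of the positive parts of `x`, to which each vertex outside Z
        -- contributes at least 1.
        complement-bound : + n - z ≤ S + Y
        complement-bound = begin
          + n - z                             ≡⟨ cong (λ m → m - z) (sum-one n) ⟨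
          sum (one {n}) - z                   ≡⟨ e (sum (one {n})) z ⟩
          1ℤ * sum (one {n}) + -1ℤ * z        ≡⟨ sum-linear 1ℤ -1ℤ one s ⟨
          sum (λ v → 1ℤ * 1ℤ + -1ℤ * s v)     ≤⟨ sum-mono (λ v → certificate (gap (1-nonposBit≤ (x v))) (e′ (x v) (s v))) ⟩
          sum (λ v → 1ℤ * (x v - s v * x v))  ≡⟨ x-sx 1ℤ ⟩
          1ℤ * (S + Y)                        ≡⟨ *-identityˡ _ ⟩
          S + Y ∎
          where
          e : ∀ a b → a - b ≡ 1ℤ * a + -1ℤ * b
          e = solve-∀
          e′ : ∀ x s → x - s * x - (1ℤ - s) ≡ 1ℤ * (x - s * x) - (1ℤ * 1ℤ + -1ℤ * s)
          e′ = solve-∀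

        weighted-deg : ∀ h → ⟨ h , deg ⟩ ≡ (q + 1ℤ) * sum h - ⟨ h , x ⟩
        weighted-deg h = begin-equality
          ⟨ h , deg ⟩                                          ≡⟨ sum-cong-≗ (λ v → e q (h v) (deg v)) ⟩
          sum (λ v → (q + 1ℤ) * h v + -1ℤ * (h v * x v))       ≡⟨ sum-linear (q + 1ℤ) -1ℤ h (λ v → h v * x v) ⟩
          (q + 1ℤ) * sum h + -1ℤ * ⟨ h , x ⟩                   ≡⟨ cong (λ m → (q + 1ℤ) * sum h + m) (-1*i≡-i ⟨ h , x ⟩) ⟩
          (q + 1ℤ) * sum h - ⟨ h , x ⟩ ∎
          where
          e : ∀ q h d → h * d ≡ (q + 1ℤ) * h + -1ℤ * (h * (q + 1ℤ - d))
          e = solve-∀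

        -- With constant weight the right side of `weighted-bound` is `⟨ x , deg ⟩`, where `N`
        -- occurs with a minus sign.
        N-bound : N ≤ (+ 2 * q + + 1) * S - (q * q + q + + 1 - r) * r
        N-bound = certificate (gap bound) (e q r S N)
          where
          bound : r * (q * q + q + 1ℤ - r) - q * S ≤ (q + 1ℤ) * S - N
          bound = begin
            r * (q * q + q + 1ℤ - r) - q * S       ≡⟨ cong₂ (λ m y → r * m - q * y) (trans (sum-one n) n≡) (⟨one,⟩ x) ⟨
            r * sum (one {n}) - q * ⟨ one , x ⟩    ≤⟨ weighted-bound one (λ _ → +≤+ z≤n) ⟩
            ⟨ x , deg ⟩                            ≡⟨ weighted-deg x ⟩
            (q + 1ℤ) * S - N ∎
          e : ∀ q r S N → (q + 1ℤ) * S - N - (r * (q * q + q + 1ℤ - r) - q * S)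
            ≡ (+ 2 * q + + 1) * S - (q * q + q + + 1 - r) * r - N
          e = solve-∀

        -- `T` equals `⟨ s , A (A s) ⟩`, and `A²-bound` applies. Since `s` is idempotent, each
        -- vertex of Z contributes `z + deg v - 1 = z + q - x v`.
        T-bound : T ≤ z * z + q * z + Y
        T-bound = begin
          ⟨ A s , A s ⟩                                ≡⟨ A-adjoint (A s) s ⟩
          ⟨ s , A (A s) ⟩
            ≤⟨ sum-mono (λ v → certificate (0≤s v ⊗ gap (A²-bound s 0≤s v)) (distrib (s v) _ _)) ⟩
          sum (λ v → s v * (z + s v * (deg v - 1ℤ)))   ≡⟨ sum-cong-≗ pointwise ⟩
          sum (λ v → (z + q) * s v + -1ℤ * (s v * x v)) ≡⟨ sum-linear (z + q) -1ℤ s _ ⟩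
          (z + q) * z + -1ℤ * ⟨ s , x ⟩                ≡⟨ e z q _ ⟩
          z * z + q * z + Y ∎
          where
          distrib : ∀ s a b → s * (b - a) ≡ s * b - s * a
          distrib = solve-∀
          e : ∀ z q y → (z + q) * z + -1ℤ * y ≡ z * z + q * z + - y
          e = solve-∀
          e₁ : ∀ z s d → s * (z + s * (d - 1ℤ)) ≡ s * z + s * s * (d - 1ℤ)
          e₁ = solve-∀
          e₂ : ∀ q z s d → s * z + s * (d - 1ℤ) ≡ (z + q) * s + -1ℤ * (s * (q + 1ℤ - d))
          e₂ = solve-∀
          pointwise : ∀ v → s v * (z + s v * (deg v - 1ℤ)) ≡ (z + q) * s v + -1ℤ * (s v * x v)
          pointwise v = trans (e₁ z (s v) (deg v))
            (trans (cong (λ i → s v * z + i * (deg v - 1ℤ)) (nonposBit-idem (x v))) (e₂ q z (s v) (deg v)))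

        -- Double counting: the sum equals the total degree over Z.
        sum-t : sum t ≡ (q + 1ℤ) * z + Y
        sum-t = begin-equality
          sum t             ≡⟨ ⟨one,⟩ t ⟨
          ⟨ one , A s ⟩     ≡⟨ A-adjoint one s ⟩
          ⟨ s , deg ⟩       ≡⟨ weighted-deg s ⟩
          (q + 1ℤ) * z + Y  ∎

        0≤Y : 0ℤ ≤ Y
        0≤Y = neg-mono-≤ {⟨ s , x ⟩} {0ℤ} (≤-trans (sum-mono (λ v → nonposBit*≤0 (x v))) (≤-reflexive (sum-replicate-zero n)))

        -- The square is (11 q x − (q t − z))², where 11² ≈ 0.85 q⁵ / (q² · 0.007 q³) balances
        -- q² Σ x² against Σ (q t − z)² ≤ q³ z + q² Y.
        sq-bound : 0ℤ ≤ + 121 * q * q * N + q * q * T + (q * q + q + + 1 - r) * z * z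
          - + 22 * q * q * X + + 22 * q * z * S - + 2 * q * z * ((q + + 1) * z + Y)
        sq-bound = begin
          0ℤ ≤⟨ sum-nonneg (λ v → square-nonneg (+ 11 * q * x v + - q * t v + z)) ⟩
          sum (λ v → (+ 11 * q * x v + - q * t v + z) * (+ 11 * q * x v + - q * t v + z))
            ≡⟨ sum-affine-square (+ 11 * q) (- q) z x t ⟩
          _ ≡⟨ cong₂ (λ m y → + 11 * q * (+ 11 * q) * N + - q * - q * T + z * z * m
                  + + 2 * (+ 11 * q) * - q * X + + 2 * (+ 11 * q) * z * S + + 2 * - q * z * y)
                (trans (sum-one n) n≡) sum-t ⟩
          _ ≡⟨ e q r z S Y N X T ⟩
          _ ∎
          where
          e : ∀ q r z S Y N X T →
            + 11 * q * (+ 11 * q) * N + - q * - q * T + z * z * (q * q + q + 1ℤ - r)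
              + + 2 * (+ 11 * q) * - q * X + + 2 * (+ 11 * q) * z * S + + 2 * - q * z * ((q + 1ℤ) * z + Y)
            ≡ + 121 * q * q * N + q * q * T + (q * q + q + + 1 - r) * z * z
              - + 22 * q * q * X + + 22 * q * z * S - + 2 * q * z * ((q + + 1) * z + Y)
          e = solve-∀

        -- From total deficiency to the number of edges.

        S-formula : S ≡ (q + 1ℤ) * (q * q + q + 1ℤ - r) - + 2 * + edgeCount G
        S-formula = begin-equality
          S                               ≡⟨ e ((q + 1ℤ) * sum (one {n})) S ⟩
          (q + 1ℤ) * sum (one {n}) - ((q + 1ℤ) * sum (one {n}) - S)
            ≡⟨ cong₂ (λ m y → (q + 1ℤ) * m - y) (trans (sum-one n) n≡) degree-sum ⟩
          (q + 1ℤ) * (q * q + q + 1ℤ - r) - + 2 * + edgeCount G ∎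
          where
          e : ∀ a b → b ≡ a - (a - b)
          e = solve-∀
          degree-sum : (q + 1ℤ) * sum (one {n}) - S ≡ + 2 * + edgeCount G
          degree-sum = begin-equality
            (q + 1ℤ) * sum (one {n}) - S               ≡⟨ cong (λ y → (q + 1ℤ) * sum (one {n}) - y) (⟨one,⟩ x) ⟨
            (q + 1ℤ) * sum (one {n}) - ⟨ one , x ⟩     ≡⟨ weighted-deg one ⟨
            ⟨ one , deg ⟩                              ≡⟨ ⟨one,⟩ deg ⟩
            sum deg                                    ≡⟨ sum-deg ⟩
            + 2 * + edgeCount G ∎

        -- Many edges force `S ≤ 0.84 r q + q + 1 - r`. For `r ≥ 100` the term `q` is at most
        -- `0.01 r q` and `1 - r` is negative; this is where the threshold on `r` comes from.
        S-small : + 100 ≤ r → 0ℤ ≤ q →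
          + 50 * q * ((q + 1ℤ) * (q + 1ℤ)) ≤ + 100 * + edgeCount G + + 92 * r * q →
          + 20 * S ≤ + 17 * r * q
        S-small 100≤r 0≤q h = subst (λ y → + 20 * y ≤ + 17 * r * q) (≡-sym S-formula)
          (*-cancelˡ-≤-pos _ _ (+ 5) (certificate
            (0≤+ 2 ⊗ gap h ⊕ 0≤q ⊗ gap 100≤r ⊕ 0≤+ 100 ⊗ (gap 100≤r ⊕ 0≤+ 99)) (e q r (+ edgeCount G))))
          where
          e : ∀ q r m → + 2 * (+ 100 * m + + 92 * r * q - + 50 * q * ((q + 1ℤ) * (q + 1ℤ)))
              + q * (r - + 100) + + 100 * (r - + 100 + + 99)
            ≡ + 5 * (+ 17 * r * q) - + 5 * (+ 20 * ((q + 1ℤ) * (q * q + q + 1ℤ - r) - + 2 * m))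
          e = solve-∀

        -- The factor 100 makes the coefficients 1/2 and 0.92 integral. If the bound fails,
        -- `S-small` supplies the last hypothesis of the numerical contradiction.
        edge-bound : 1ℤ ≤ q → + 100 ≤ r → + 100 * r ≤ q →
          + 100 * + edgeCount G + + 92 * r * q ≤ + 50 * q * ((q + 1ℤ) * (q + 1ℤ))
        edge-bound 1≤q 100≤r 100r≤q
          with + 100 * + edgeCount G + + 92 * r * q ≤? + 50 * q * ((q + 1ℤ) * (q + 1ℤ))
        ... | yes bound = bound
        ... | no ¬bound = ⊥-elim (numerical-contradiction q r z S Y N X T 1≤q
                (≤-trans (+≤+ (s≤s z≤n)) 100≤r) 100r≤q (sum-nonneg 0≤s) 0≤Y
                (S-small 100≤r 0≤q (<⇒≤ (≰⇒> ¬bound)))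
                X-lower (X-upper 0≤q)
                (subst (λ m → m - z ≤ S + Y) n≡ complement-bound)
                N-bound T-bound sq-bound)
          where
          0≤q : 0ℤ ≤ q
          0≤q = ≤-trans (0≤+ 1) 1≤q

-- Transfer to natural numbers.

open import Data.Nat using (_+_; _*_; _∸_; _≤_)

theorem1p3 : Σ ℕ λ R₀ → (q r : ℕ) → 1 ≤ q → R₀ ≤ r → 100 * r ≤ q →
    (G : Graph (q * q + q + 1 ∸ r)) → C4Free G →
    100 * edgeCount G + 92 * r * q ≤ 50 * q * ((q + 1) * (q + 1))
theorem1p3 = 100 , λ q r 1≤q 100≤r 100r≤q G free →
  -- Since `r ≤ 100 r ≤ q ≤ q² + q + 1`, the truncated subtraction in the vertex count is a true
  -- subtraction in the integers.
  let r≤n = ℕ.≤-trans (ℕ.≤-trans (ℕ.m≤n*m r 100) 100r≤q) (ℕ.≤-trans (ℕ.m≤n+m q (q * q)) (ℕ.m≤m+n (q * q + q) 1))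
      n≡ = trans (≡-sym (ℤ.⊖-≥ r≤n)) (trans (≡-sym (ℤ.m-n≡m⊖n (q * q + q + 1) r))
             (cong (λ m → m ℤ.+ ℤ.+ q ℤ.+ ℤ.1ℤ ℤ.- ℤ.+ r) (ℤ.pos-* q q)))
  in ℤ.drop‿+≤+ (subst₂ ℤ._≤_
       (≡-sym (cong₂ ℤ._+_ (ℤ.pos-* 100 (edgeCount G)) (pos-*₃ 92 r q)))
       (≡-sym (trans (ℤ.pos-* (50 * q) ((q + 1) * (q + 1)))
         (cong₂ ℤ._*_ (ℤ.pos-* 50 q) (ℤ.pos-* (q + 1) (q + 1)))))
       (DegreeDeficiency.edge-bound G free (ℤ.+ q) (ℤ.+ r) n≡ (ℤ.+≤+ 1≤q) (ℤ.+≤+ 100≤r)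
         (subst (ℤ._≤ ℤ.+ q) (ℤ.pos-* 100 r) (ℤ.+≤+ 100r≤q))))
  where
  pos-*₃ : ∀ l m n → ℤ.+ (l * m * n) ≡ ℤ.+ l ℤ.* ℤ.+ m ℤ.* ℤ.+ n
  pos-*₃ l m n = trans (ℤ.pos-* (l * m) n) (cong (ℤ._* ℤ.+ n) (ℤ.pos-* l m))
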